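{- Let $L_1,L_2$ be disjoint first-order languages without function symbols, each containing at least one constant symbol, and let $T_1,T_2$ be an $L_1$-theory and an $L_2$-theory. Let $T_{\mathrm{sim}}$ be the theory of simple products of $T_1$ and $T_2$. If $\mathcal M_k$ is a model of $T_k$ for $k=1,2$, then the standard simple product of $\mathcal M_1$ and $\mathcal M_2$ is a model of $T_{\mathrm{sim}}$. Conversely, every model of $T_{\mathrm{sim}}$ is isomorphic to the standard simple product of some model of $T_1$ and some model of $T_2$.
   Context: Language of simple product $L_{\mathrm{sim}}$: for each pair $(c_1,c_2)$ with $c_1$ a constant of $L_1$ and $c_2$ a constant of $L_2$ there is a constant symbol $C_{(c_1,c_2)}$ (and no other constants); its predicate symbols are those of $L_1$, those of $L_2$ (same arities), and two binary predicates $\sim_1,\sim_2$. $T_\times$ is the theory stating: $\sim_1,\sim_2$ are equivalence relations; $\forall x\forall y((x\sim_1y)\wedge(x\sim_2y)\to x=y)$; $\forall x\forall y\exists z((x\sim_1z)\wedge(y\sim_2z))$. For tuples, $\bar x\sim_k\bar y$ means $\bigwedge_i x_i\sim_k y_i$. Standard conversion: for an $L_k$-formula $\phi$, its standard conversion $\widetilde\phi$ is the $L_{\mathrm{sim}}$-formula defined by induction: first rewrite atomic formulas $R(\bar t)$ in which constants occur as $\exists\bar y(R(\bar y)\wedge\bigwedge_i t_i=y_i)$; an equality $x=y$ of variables becomes $x\sim_k y$; an equality between a variable $x$ and a constant $c$ of $L_k$ becomes $x\sim_k C$, where $C$ is $C_{(c,d)}$ (if $k=1$) or $C_{(d,c)}$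 (if $k=2$) for an arbitrary fixed constant $d$ of the other language; an equality of two constants $c,c'$ of $L_k$ becomes $C\sim_k C'$ similarly; $R(\bar x)$ with $R\in L_k$ and $\bar x$ variables stays $R(\bar x)$; the conversion commutes with Boolean connectives and existential quantification. The theory of simple products $T_{\mathrm{sim}}$ of $T_1,T_2$ consists of $T_\times$, all $\widetilde\sigma$ for $\sigma\in T_1\cup T_2$, and for each $k=1,2$ and each predicate $R$ of $L_k$ the sentence $\forall\bar x\forall\bar y((\bar x\sim_k\bar y)\to(R(\bar x)\leftrightarrow R(\bar y)))$. The standard simple product of an $L_1$-structure $\mathcal M_1$ (universe $M_1$) and an $L_2$-structure $\mathcal M_2$ (universe $M_2$) is the $L_{\mathrm{sim}}$-structure with universe $M_1\times M_2$, where $C_{(c_1,c_2)}$ is interpreted as $(c_1^{\mathcal M_1},c_2^{\mathcal M_2})$, $x\sim_k y$ iff $\pi_k(x)=\pi_k(y)$ ($\pi_k$ the projection to $M_k$), and for $R\in L_k$ $n$-ary, $R(\bar c)$ holds iff $\mathcal M_k\models R(\pi_k(\bar c))$ (with $\pi_k$ applied coordinatewise).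
   Formalization: The converse is false as stated and is proved for models of T_sim that also satisfy C_(c,d) ∼₁ C_(c,d') and C_(c,d) ∼₂ C_(c',d) for all constants, a condition that holds in every standard simple product. -}

module Defs where

open import Data.Empty.Polymorphic using (⊥)
open import Data.Fin using (Fin; zero; suc; _↑ˡ_; _↑ʳ_)
open import Data.Maybe as Maybe using (Maybe; just; nothing)
open import Data.Nat using (ℕ; zero; suc; _+_)
open import Data.Product using (Σ; _×_; _,_; proj₁; proj₂)
open import Data.Product.Relation.Binary.Pointwise.NonDependent using (×-setoid)
open import Data.Sum using (_⊎_)
open import Data.Unit.Polymorphic using (⊤)
open import Data.Vec using (Vec; []; _∷_; lookup; map; tabulate; zipWith; foldr′)
open import Data.Vec.Relation.Binary.Pointwise.Inductive as PW using (Pointwise; []; _∷_)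
open import Function.Bundles using (Bijection; _⇔_)
open import Level using (Level; _⊔_) renaming (suc to lsuc)
open import Relation.Binary.Bundles using (Setoid)

private
  variable
    l t u : Level
    m n : ℕ

record Language (l : Level) : Set (lsuc l) where
  field
    Const : Set l
    Rel   : Set l
    arity : Rel → ℕ

open Language public

data Term (L : Language l) (n : ℕ) : Set l where
  var   : Fin n → Term L n
  const : Const L → Term L n

infix  8 _≐_
infix  7 ¬′_
infixr 6 _∧′_
infixr 5 _∨′_
infixr 4 _⇒′_

-- Formulas with free variables among Fin n (de Bruijn indices).  Both
-- quantifiers are primitive: the metatheory is constructive, so ∀ cannot be
-- taken to abbreviate ¬∃¬.
data Formula (L : Language l) : ℕ → Set l where
  _≐_       : Term L n → Term L n → Formula L n
  rel       : (R : Rel L) → Vec (Term L n) (arity L R) → Formula L n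
  ⊤′ ⊥′     : Formula L n
  ¬′_       : Formula L n → Formula L n
  _∧′_ _∨′_ : Formula L n → Formula L n → Formula L n
  _⇒′_      : Formula L n → Formula L n → Formula L n
  ∃′ ∀′     : Formula L (suc n) → Formula L n

Sentence : Language l → Set l
Sentence L = Formula L 0

Theory : Language l → (t : Level) → Set (l ⊔ lsuc t)
Theory L t = Sentence L → Set t

module _ {L : Language l} where

  infix 4 _⇔′_

  _⇔′_ : Formula L n → Formula L n → Formula L n
  φ ⇔′ ψ = (φ ⇒′ ψ) ∧′ (ψ ⇒′ φ)

  ⋀ : Vec (Formula L n) m → Formula L n
  ⋀ = foldr′ _∧′_ ⊤′

  -- The block of m variables bound by ∃* or ∀* consists of the indices
  -- i ↑ˡ n; an outer variable j becomes m ↑ʳ j.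
  ∃* ∀* : ∀ m → Formula L (m + n) → Formula L n
  ∃* zero    φ = φ
  ∃* (suc m) φ = ∃* m (∃′ φ)
  ∀* zero    φ = φ
  ∀* (suc m) φ = ∀* m (∀′ φ)

  block : ∀ m n → Vec (Term L (m + n)) m
  block m n = tabulate (λ i → var (i ↑ˡ n))

  shift : ∀ m → Term L n → Term L (m + n)
  shift m (var j)   = var (m ↑ʳ j)
  shift m (const c) = const c

  allVars : Vec (Term L n) m → Maybe (Vec (Fin n) m)
  allVars []             = just []
  allVars (var i ∷ ts)   = Maybe.map (i ∷_) (allVars ts)
  allVars (const c ∷ ts) = nothing

-- The universe is a setoid whose equality interprets the equality symbol
-- (Agda has no quotient types), so relations must respect that equality.
record Structure (L : Language l) (u : Level) : Set (l ⊔ lsuc u) where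
  field
    setoid : Setoid u u
  open Setoid setoid public using (Carrier; _≈_)
  field
    constᴹ    : Const L → Carrier
    relᴹ      : (R : Rel L) → Vec Carrier (arity L R) → Set u
    relᴹ-resp : ∀ R {xs ys} → Pointwise _≈_ xs ys → relᴹ R xs → relᴹ R ys

module _ {L : Language l} (M : Structure L u) where
  open Structure M

  ⟦_⟧ : Term L n → Vec Carrier n → Carrier
  ⟦ var i ⟧   ρ = lookup ρ i
  ⟦ const c ⟧ ρ = constᴹ c

  Sat : Formula L n → Vec Carrier n → Set u
  Sat (s ≐ s′)   ρ = ⟦ s ⟧ ρ ≈ ⟦ s′ ⟧ ρ
  Sat (rel R ts) ρ = relᴹ R (map (λ s → ⟦ s ⟧ ρ) ts)
  Sat ⊤′         ρ = ⊤
  Sat ⊥′         ρ = ⊥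
  Sat (¬′ φ)     ρ = Sat φ ρ → ⊥ {u}
  Sat (φ ∧′ ψ)   ρ = Sat φ ρ × Sat ψ ρ
  Sat (φ ∨′ ψ)   ρ = Sat φ ρ ⊎ Sat ψ ρ
  Sat (φ ⇒′ ψ)   ρ = Sat φ ρ → Sat ψ ρ
  Sat (∃′ φ)     ρ = Σ Carrier λ a → Sat φ (a ∷ ρ)
  Sat (∀′ φ)     ρ = ∀ a → Sat φ (a ∷ ρ)

infix 4 _⊨_ _≅_

_⊨_ : {L : Language l} → Structure L u → Theory L t → Set (l ⊔ t ⊔ u)
M ⊨ T = ∀ σ → T σ → Sat M σ []

record _≅_ {L : Language l} (M N : Structure L u) : Set (l ⊔ u) where
  private
    module M = Structure M
    module N = Structure N
  field
    bijection : Bijection M.setoid N.setoid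
  open Bijection bijection public using (to)
  field
    const-pres : ∀ c → to (M.constᴹ c) N.≈ N.constᴹ c
    rel-pres   : ∀ R xs → M.relᴹ R xs ⇔ N.relᴹ R (map to xs)

data Side : Set where
  one two : Side

module _ (L₁ L₂ : Language l) where

  lang : Side → Language l
  lang one = L₁
  lang two = L₂

  data SimRel : Set l where
    old : (k : Side) → Rel (lang k) → SimRel
    sim : Side → SimRel

  -- Disjointness of L₁ and L₂ is built in: their symbols are tagged by k.
  Lsim : Language l
  Lsim .Const           = Const L₁ × Const L₂
  Lsim .Rel             = SimRel
  Lsim .arity (old k R) = arity (lang k) R
  Lsim .arity (sim k)   = 2

module _ {L₁ L₂ : Language l} where

  infix 8 _∼[_]_

  _∼[_]_ : Term (Lsim L₁ L₂) n → Side → Term (Lsim L₁ L₂) n → Formula (Lsim L₁ L₂) n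
  s ∼[ k ] s′ = rel (sim k) (s ∷ s′ ∷ [])

  private
    pattern v₀ = var zero
    pattern v₁ = var (suc zero)
    pattern v₂ = var (suc (suc zero))

  data T× : Theory (Lsim L₁ L₂) l where
    ∼-refl  : ∀ k → T× (∀′ (v₀ ∼[ k ] v₀))
    ∼-sym   : ∀ k → T× (∀′ (∀′ (v₁ ∼[ k ] v₀ ⇒′ v₀ ∼[ k ] v₁)))
    ∼-trans : ∀ k → T× (∀′ (∀′ (∀′ (v₂ ∼[ k ] v₁ ∧′ v₁ ∼[ k ] v₀ ⇒′ v₂ ∼[ k ] v₀))))
    ∼-sep   : T× (∀′ (∀′ (v₁ ∼[ one ] v₀ ∧′ v₁ ∼[ two ] v₀ ⇒′ v₁ ≐ v₀)))
    ∼-join  : T× (∀′ (∀′ (∃′ (v₂ ∼[ one ] v₀ ∧′ v₁ ∼[ two ] v₀))))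

  -- The axiom  ∀x̄ ∀ȳ (x̄ ∼ₖ ȳ → (R(x̄) ↔ R(ȳ))).
  compatible : (k : Side) → Rel (lang L₁ L₂ k) → Sentence (Lsim L₁ L₂)
  compatible k R =
    ∀* a (∀* a (⋀ (zipWith _∼[ k ]_ xs ys) ⇒′ (rel (old k R) xs ⇔′ rel (old k R) ys)))
    where
    a  = arity (lang L₁ L₂ k) R
    xs = map (shift a) (block a 0)
    ys = block a (a + 0)

  -- The sentences saying that the k-th coordinate of C₍c₁,c₂₎ depends only
  -- on cₖ.  They hold in every standard simple product, but do not follow
  -- from Tsim below: let L₁ have one constant c, L₂ two constants d and d′,
  -- neither any predicate, and T₁, T₂ be empty; on {0,1}² with the coordinate
  -- equivalences, interpret C₍c,d₎ as (0,0) and C₍c,d′₎ as (1,1).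
  data CoherentConstants : Theory (Lsim L₁ L₂) l where
    coherent₁ : ∀ c₁ c₂ c₂′ → CoherentConstants (const (c₁ , c₂) ∼[ one ] const (c₁ , c₂′))
    coherent₂ : ∀ c₁ c₁′ c₂ → CoherentConstants (const (c₁ , c₂) ∼[ two ] const (c₁′ , c₂))

  -- d₁ and d₂ are the fixed constants used to turn a constant of one
  -- language into a constant of Lsim.
  module _ (d₁ : Const L₁) (d₂ : Const L₂) where

    C : (k : Side) → Const (lang L₁ L₂ k) → Const (Lsim L₁ L₂)
    C one c = c , d₂
    C two c = d₁ , c

    convertTerm : (k : Side) → Term (lang L₁ L₂ k) n → Term (Lsim L₁ L₂) n
    convertTerm k (var i)   = var i
    convertTerm k (const c) = const (C k c)

    convert≐ : (k : Side) → Term (lang L₁ L₂ k) n → Term (lang L₁ L₂ k) n → Formula (Lsim L₁ L₂) n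
    convert≐ k s s′ = convertTerm k s ∼[ k ] convertTerm k s′

    -- In the second case (some constant occurs in t̄) the result is the
    -- conversion of  ∃ȳ (R(ȳ) ∧ ⋀ᵢ tᵢ = yᵢ).
    convertRel : (k : Side) (R : Rel (lang L₁ L₂ k)) →
                 Vec (Term (lang L₁ L₂ k) n) (arity (lang L₁ L₂ k) R) → Formula (Lsim L₁ L₂) n
    convertRel {n} k R ts with allVars ts
    ... | just is = rel (old k R) (map var is)
    ... | nothing = ∃* a (rel (old k R) (block a n) ∧′
                          ⋀ (zipWith (convert≐ k) (map (shift a) ts) (block a n)))
      where
      a = arity (lang L₁ L₂ k) R

    convert : (k : Side) → Formula (lang L₁ L₂ k) n → Formula (Lsim L₁ L₂) n
    convert k (s ≐ s′)   = convert≐ k s s′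
    convert k (rel R ts) = convertRel k R ts
    convert k ⊤′         = ⊤′
    convert k ⊥′         = ⊥′
    convert k (¬′ φ)     = ¬′ convert k φ
    convert k (φ ∧′ ψ)   = convert k φ ∧′ convert k ψ
    convert k (φ ∨′ ψ)   = convert k φ ∨′ convert k ψ
    convert k (φ ⇒′ ψ)   = convert k φ ⇒′ convert k ψ
    convert k (∃′ φ)     = ∃′ (convert k φ)
    convert k (∀′ φ)     = ∀′ (convert k φ)

    data Tsim (T₁ : Theory L₁ t) (T₂ : Theory L₂ t) : Theory (Lsim L₁ L₂) (l ⊔ t) where
      product    : ∀ {σ} → T× σ → Tsim T₁ T₂ σ
      converted₁ : ∀ {σ} → T₁ σ → Tsim T₁ T₂ (convert one σ)
      converted₂ : ∀ {σ} → T₂ σ → Tsim T₁ T₂ (convert two σ)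
      compat     : ∀ k R → Tsim T₁ T₂ (compatible k R)

  infixr 7 _⊗_

  _⊗_ : Structure L₁ u → Structure L₂ u → Structure (Lsim L₁ L₂) u
  M₁ ⊗ M₂ = record
    { setoid    = ×-setoid M₁.setoid M₂.setoid
    ; constᴹ    = λ (c₁ , c₂) → M₁.constᴹ c₁ , M₂.constᴹ c₂
    ; relᴹ      = R⊗
    ; relᴹ-resp = resp
    }
    where
    module M₁ = Structure M₁
    module M₂ = Structure M₂
    module S₁ = Setoid M₁.setoid
    module S₂ = Setoid M₂.setoid
    module S⊗ = Setoid (×-setoid M₁.setoid M₂.setoid)

    R⊗ : (R : SimRel L₁ L₂) → Vec S⊗.Carrier (arity (Lsim L₁ L₂) R) → Set _
    R⊗ (old one R) xs           = M₁.relᴹ R (map proj₁ xs)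
    R⊗ (old two R) xs           = M₂.relᴹ R (map proj₂ xs)
    R⊗ (sim one)   (x ∷ y ∷ []) = proj₁ x M₁.≈ proj₁ y
    R⊗ (sim two)   (x ∷ y ∷ []) = proj₂ x M₂.≈ proj₂ y

    resp : ∀ R {xs ys} → Pointwise S⊗._≈_ xs ys → R⊗ R xs → R⊗ R ys
    resp (old one R) ps = M₁.relᴹ-resp R (PW.map⁺ proj₁ ps)
    resp (old two R) ps = M₂.relᴹ-resp R (PW.map⁺ proj₂ ps)
    resp (sim one) (p ∷ q ∷ []) e = S₁.trans (S₁.sym (proj₁ p)) (S₁.trans e (proj₁ q))
    resp (sim two) (p ∷ q ∷ []) e = S₂.trans (S₂.sym (proj₂ p)) (S₂.trans e (proj₂ q))

{-# OPTIONS --safe #-}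
-- For the converse, take M_k to be N itself with ∼ₖ as its equality; then
-- x ↦ (x , x) is the isomorphism.  Both directions rest on one transfer lemma:
-- if π maps N onto M so that ∼ₖ is the kernel of π and the relations of the
-- k-th language are pulled back along π, then the conversion of φ holds at ρ
-- in N iff φ holds at π ρ in M.
module Submission where

open import Data.Fin using (Fin; _↑ˡ_)
open import Data.Maybe using (just; nothing)
open import Data.Nat using (ℕ; zero; suc; _+_)
open import Data.Product using (Σ; _×_; ∃-syntax; _,_; proj₁; proj₂; map₂)
open import Data.Product.Function.NonDependent.Propositional using (_×-⇔_)
open import Data.Sum.Function.Propositional using (_⊎-⇔_)
open import Data.Unit.Polymorphic using (tt)
open import Data.Vec using (Vec; []; _∷_; _++_; lookup; map; tabulate; zipWith)
open import Data.Vec.Properties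
  using (lookup-++ˡ; lookup-++ʳ; map-∘; map-cong; map-id; tabulate-∘; tabulate-cong; tabulate∘lookup)
open import Data.Vec.Relation.Binary.Pointwise.Inductive as PW using (Pointwise; []; _∷_)
open import Function using (id)
open import Function.Bundles using (_⇔_; mk⇔; Equivalence)
open import Function.Construct.Composition using (_⇔-∘_)
open import Function.Construct.Identity using (⇔-id)
open import Function.Construct.Symmetry using (⇔-sym)
open import Function.Related.TypeIsomorphisms using (→-cong-⇔)
open import Level using (Level; _⊔_)
open import Relation.Binary.Bundles using (Setoid)
open import Relation.Binary.PropositionalEquality
  using (_≡_; refl; sym; trans; cong; subst; module ≡-Reasoning)
open import Defs

open Equivalence using (to; from)

private
  variable
    ℓ l t u : Level
    A : Set ℓ
    m n : ℕ

-- Congruences of logical equivalence, and tuples of variables.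

≡⇒⇔ : {P Q : Set ℓ} → P ≡ Q → P ⇔ Q
≡⇒⇔ refl = ⇔-id _

Π-⇔ : {P Q : A → Set u} → (∀ x → P x ⇔ Q x) → (∀ x → P x) ⇔ (∀ x → Q x)
Π-⇔ P⇔Q = mk⇔ (λ p x → to (P⇔Q x) (p x)) (λ q x → from (P⇔Q x) (q x))

Σ-⇔ : {P Q : A → Set u} → (∀ x → P x ⇔ Q x) → Σ A P ⇔ Σ A Q
Σ-⇔ P⇔Q = mk⇔ (map₂ (to (P⇔Q _))) (map₂ (from (P⇔Q _)))

-- Turns a successful test in `convertRel` into the form of the arguments: they are all variables.
allVars-just : {L : Language l} (ts : Vec (Term L n) m) {is : Vec (Fin n) m} →
               allVars ts ≡ just is → ts ≡ map var is
allVars-just []           refl = refl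
allVars-just (var i ∷ ts) eq with allVars ts in eq′
allVars-just (var i ∷ ts) refl | just is = cong (var i ∷_) (allVars-just ts eq′)

-- `f` is arbitrary because blocks get evaluated in two ways: directly, as terms of `Lsim`, and as
-- terms of one factor language after conversion.
map-block : {L : Language l} (f : Term L (m + n) → A) (xs : Vec A m) (ρ : Vec A n) →
            (∀ i → f (var i) ≡ lookup (xs ++ ρ) i) → map f (block m n) ≡ xs
map-block {m = m} {n = n} f xs ρ f-var = begin
  map f (block m n)                      ≡⟨ tabulate-∘ f (λ i → var (i ↑ˡ n)) ⟨
  tabulate (λ i → f (var (i ↑ˡ n)))      ≡⟨ tabulate-cong (λ i → trans (f-var _) (lookup-++ˡ xs ρ i)) ⟩
  tabulate (lookup xs)                   ≡⟨ tabulate∘lookup xs ⟩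
  xs                                     ∎
  where open ≡-Reasoning

-- Truth of quantifier blocks and finite conjunctions.

module _ {L : Language l} (M : Structure L u) where
  open Structure M

  ⟦shift⟧ : (xs : Vec Carrier m) (ρ : Vec Carrier n) (s : Term L n) →
            ⟦ M ⟧ (shift m s) (xs ++ ρ) ≡ ⟦ M ⟧ s ρ
  ⟦shift⟧ xs ρ (var j)   = lookup-++ʳ xs ρ j
  ⟦shift⟧ xs ρ (const c) = refl

  ⟦block⟧ : (xs : Vec Carrier m) (ρ : Vec Carrier n) →
            map (λ s → ⟦ M ⟧ s (xs ++ ρ)) (block m n) ≡ xs
  ⟦block⟧ xs ρ = map-block _ xs ρ (λ _ → refl)

  Sat-∃* : ∀ m {φ : Formula L (m + n)} {ρ} →
           Sat M (∃* m φ) ρ ⇔ (Σ (Vec Carrier m) λ xs → Sat M φ (xs ++ ρ))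
  Sat-∃* zero    = mk⇔ (λ p → [] , p) (λ { ([] , p) → p })
  -- The quantifier added by `suc` is the innermost one, so its witness is found last yet becomes
  -- the head of the tuple.
  Sat-∃* (suc m) =
    mk⇔ (λ { (xs , x , p) → x ∷ xs , p }) (λ { (x ∷ xs , p) → xs , x , p }) ⇔-∘ Sat-∃* m

  Sat-∀* : ∀ m {φ : Formula L (m + n)} {ρ} →
           Sat M (∀* m φ) ρ ⇔ (∀ (xs : Vec Carrier m) → Sat M φ (xs ++ ρ))
  Sat-∀* zero    = mk⇔ (λ { p [] → p }) (λ p → p [])
  Sat-∀* (suc m) =
    mk⇔ (λ { p (x ∷ xs) → p xs x }) (λ p xs x → p (x ∷ xs)) ⇔-∘ Sat-∀* m

  -- `S` need not consist of terms of `L`: the lemma serves both `_∼[ k ]_` on terms of `Lsim` and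
  -- `convert≐` on terms of a factor language.
  Sat-⋀-zipWith :
    {S : Set ℓ} {F : S → S → Formula L n} {ρ : Vec Carrier n}
    {Q : Carrier → Carrier → Set u} (f : S → Carrier) →
    (∀ s s′ → Sat M (F s s′) ρ ⇔ Q (f s) (f s′)) →
    (ss ss′ : Vec S m) →
    Sat M (⋀ (zipWith F ss ss′)) ρ ⇔ Pointwise Q (map f ss) (map f ss′)
  Sat-⋀-zipWith f F⇔Q []       []         = mk⇔ (λ _ → []) (λ _ → tt)
  Sat-⋀-zipWith f F⇔Q (s ∷ ss) (s′ ∷ ss′) =
    mk⇔ (λ (p , ps) → p ∷ ps) (λ { (p ∷ ps) → p , ps })
    ⇔-∘ (F⇔Q s s′ ×-⇔ Sat-⋀-zipWith f F⇔Q ss ss′)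

-- The compatibility axioms, read in a structure.

module _ {L₁ L₂ : Language l} (N : Structure (Lsim L₁ L₂) u) (k : Side) where
  open Structure N

  _≋_ : Carrier → Carrier → Set u
  x ≋ y = relᴹ (sim k) (x ∷ y ∷ [])

  Compatible : Rel (lang L₁ L₂ k) → Set u
  Compatible R = ∀ xs ys → Pointwise _≋_ xs ys → relᴹ (old k R) xs ⇔ relᴹ (old k R) ys

  Sat-compatible : ∀ R → Sat N (compatible k R) [] ⇔ Compatible R
  Sat-compatible R =
    Π-⇔ (λ xs → Π-⇔ (λ ys → matrix xs ys) ⇔-∘ Sat-∀* N a) ⇔-∘ Sat-∀* N a
    where
    a  = arity (lang L₁ L₂ k) R
    ss = map (shift a) (block a 0)
    ts = block a (a + 0)

    -- The block `ys` is bound inside the block `xs`, so it comes first in the environment; this is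
    -- why the variables of `xs` are shifted.
    matrix : ∀ xs ys →
      Sat N (⋀ (zipWith _∼[ k ]_ ss ts) ⇒′ (rel (old k R) ss ⇔′ rel (old k R) ts)) (ys ++ xs ++ [])
      ⇔ (Pointwise _≋_ xs ys → relᴹ (old k R) xs ⇔ relᴹ (old k R) ys)
    matrix xs ys =
      →-cong-⇔
        (≡⇒⇔ (evaluated (Pointwise _≋_)) ⇔-∘ Sat-⋀-zipWith N eval (λ _ _ → ⇔-id _) ss ts)
        (mk⇔ (λ (f , g) → mk⇔ f g) (λ e → to e , from e)
         ⇔-∘ ≡⇒⇔ (evaluated λ xs ys → (relᴹ (old k R) xs → relᴹ (old k R) ys)
                                   × (relᴹ (old k R) ys → relᴹ (old k R) xs)))
      where
      eval : Term (Lsim L₁ L₂) (a + (a + 0)) → Carrier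
      eval s = ⟦ N ⟧ s (ys ++ xs ++ [])

      ss≡xs : map eval ss ≡ xs
      ss≡xs = trans (sym (map-∘ eval (shift a) (block a 0)))
                    (trans (map-cong (⟦shift⟧ N ys (xs ++ [])) (block a 0)) (⟦block⟧ N xs []))

      -- With `f` arbitrary, one rewriting of both blocks serves the premise and the conclusion of
      -- the axiom alike.
      evaluated : ∀ {b} {B : Set b} (f : Vec Carrier a → Vec Carrier a → B) →
               f (map eval ss) (map eval ts) ≡ f xs ys
      evaluated f rewrite ss≡xs | ⟦block⟧ N ys (xs ++ []) = refl

-- Coordinate maps and the transfer of converted formulas.

module _ {L₁ L₂ : Language l} (d₁ : Const L₁) (d₂ : Const L₂) where

  -- Common to the projections of a standard product and to the identity from a model to its
  -- quotient by ∼ₖ. Only ∼ₖ is compared with equality in `M`, since `convert` turns every `≐` into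
  -- ∼ₖ.
  record Coordinate (k : Side) (N : Structure (Lsim L₁ L₂) u)
                    (M : Structure (lang L₁ L₂ k) u) : Set (l ⊔ u) where
    private
      module N = Structure N
      module M = Structure M
    field
      π       : N.Carrier → M.Carrier
      π-surj  : ∀ a → Σ N.Carrier λ x → π x M.≈ a
      π-sim   : ∀ x y → _≋_ N k x y ⇔ π x M.≈ π y
      π-rel   : ∀ R xs → N.relᴹ (old k R) xs ⇔ M.relᴹ R (map π xs)
      π-const : ∀ c → π (N.constᴹ (C {L₁ = L₁} {L₂} d₁ d₂ k c)) M.≈ M.constᴹ c

  module Transfer {k : Side} {N : Structure (Lsim L₁ L₂) u}
                  {M : Structure (lang L₁ L₂ k) u} (coord : Coordinate k N M) where
    private
      module N = Structure N
      module M = Structure M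
      module E = Setoid M.setoid
      L = lang L₁ L₂ k
    open Coordinate coord

    -- Environments are related by `Over` rather than by applying `π`, because `π` reaches an
    -- element of `M` only up to the equality of `M`.
    Over : N.Carrier → M.Carrier → Set u
    Over x a = π x M.≈ a

    rel-over : ∀ R {xs as} → Pointwise Over xs as → N.relᴹ (old k R) xs ⇔ M.relᴹ R as
    rel-over R {xs} {as} ps =
      mk⇔ (M.relᴹ-resp R πxs≈as) (M.relᴹ-resp R (PW.sym E.sym πxs≈as)) ⇔-∘ π-rel R xs
      where
      πxs≈as : Pointwise M._≈_ (map π xs) as
      πxs≈as = subst (Pointwise M._≈_ _) (map-id as) (PW.map⁺ id ps)

    sim-over : ∀ {x y a b} → Over x a → Over y b → _≋_ N k x y ⇔ a M.≈ b
    sim-over p q =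
      mk⇔ (λ e → E.trans (E.sym p) (E.trans e q)) (λ e → E.trans p (E.trans e (E.sym q)))
      ⇔-∘ π-sim _ _

    π-over : (xs : Vec N.Carrier n) → Pointwise Over xs (map π xs)
    π-over []       = []
    π-over (x ∷ xs) = E.refl ∷ π-over xs

    -- Tuples related by ∼ₖ have equal images under `π`, and `R` is decided on the images.
    compatible-rel : ∀ R → Compatible N k R
    compatible-rel R xs ys ps =
      ⇔-sym (π-rel R ys)
      ⇔-∘ rel-over R (PW.trans (λ p q → E.trans (to (π-sim _ _) p) q) ps (π-over ys))

    ⟪_⟫ : Term L n → Vec N.Carrier n → N.Carrier
    ⟪ s ⟫ ρ = ⟦ N ⟧ (convertTerm {L₁ = L₁} {L₂} d₁ d₂ k s) ρ

    ⟪shift⟫ : (xs : Vec N.Carrier m) (ρ : Vec N.Carrier n) (s : Term L n) →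
              ⟪ shift m s ⟫ (xs ++ ρ) ≡ ⟪ s ⟫ ρ
    ⟪shift⟫ xs ρ (var j)   = lookup-++ʳ xs ρ j
    ⟪shift⟫ xs ρ (const c) = refl

    term-over : ∀ {ρ σ} → Pointwise Over ρ σ → (s : Term L n) → Over (⟪ s ⟫ ρ) (⟦ M ⟧ s σ)
    term-over ps (var i)   = PW.lookup ps i
    term-over ps (const c) = π-const c

    terms-over : ∀ {ρ σ} → Pointwise Over ρ σ → (ss : Vec (Term L n) m) →
                 Pointwise Over (map (λ s → ⟪ s ⟫ ρ) ss) (map (λ s → ⟦ M ⟧ s σ) ss)
    terms-over ps []       = []
    terms-over ps (s ∷ ss) = term-over ps s ∷ terms-over ps ss

    -- The formula is what `convertRel` yields when a constant occurs among the arguments; its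
    -- equalities have become ∼ₖ, so the witness is determined only up to ∼ₖ.
    Sat-∃-block : ∀ R (ts : Vec (Term L n) (arity L R)) ρ → let a = arity L R in
      Sat N (∃* a (rel (old k R) (block a n) ∧′
                   ⋀ (zipWith (convert≐ {L₁ = L₁} {L₂} d₁ d₂ k) (map (shift a) ts) (block a n)))) ρ
      ⇔ (Σ (Vec N.Carrier a) λ xs →
           N.relᴹ (old k R) xs × Pointwise (_≋_ N k) (map (λ s → ⟪ s ⟫ ρ) ts) xs)
    Sat-∃-block {n = n} R ts ρ = Σ-⇔ matrix ⇔-∘ Sat-∃* N a
      where
      a = arity L R

      matrix : ∀ xs →
        Sat N (rel (old k R) (block a n) ∧′
               ⋀ (zipWith (convert≐ {L₁ = L₁} {L₂} d₁ d₂ k) (map (shift a) ts) (block a n))) (xs ++ ρ)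
        ⇔ (N.relᴹ (old k R) xs × Pointwise (_≋_ N k) (map (λ s → ⟪ s ⟫ ρ) ts) xs)
      matrix xs =
        ≡⇒⇔ (cong (N.relᴹ (old k R)) (⟦block⟧ N xs ρ))
        ×-⇔ (≡⇒⇔ pointwise≡
             ⇔-∘ Sat-⋀-zipWith N eval (λ _ _ → ⇔-id _) (map (shift a) ts) (block a n))
        where
        eval : Term L (a + n) → N.Carrier
        eval s = ⟪ s ⟫ (xs ++ ρ)

        ts≡ : map eval (map (shift a) ts) ≡ map (λ s → ⟪ s ⟫ ρ) ts
        ts≡ = trans (sym (map-∘ eval (shift a) ts)) (map-cong (⟪shift⟫ xs ρ) ts)

        pointwise≡ : Pointwise (_≋_ N k) (map eval (map (shift a) ts)) (map eval (block a n))
                     ≡ Pointwise (_≋_ N k) (map (λ s → ⟪ s ⟫ ρ) ts) xs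
        pointwise≡ rewrite ts≡ | map-block eval xs ρ (λ _ → refl) = refl

    Sat-convertRel : ∀ {ρ σ} → Pointwise Over ρ σ → ∀ R (ts : Vec (Term L n) (arity L R)) →
      Sat N (convertRel {L₁ = L₁} {L₂} d₁ d₂ k R ts) ρ ⇔ Sat M (rel R ts) σ
    Sat-convertRel {ρ = ρ} {σ} ps R ts with allVars ts in eq
    -- For variables, evaluation after conversion and evaluation in `N` are both lookup in `ρ`.
    ... | just is rewrite allVars-just ts eq =
      rel-over R (subst (λ xs → Pointwise Over xs _) ⟪vars⟫ (terms-over ps (map var is)))
      where
      ⟪vars⟫ : map (λ s → ⟪ s ⟫ ρ) (map var is) ≡ map (λ s → ⟦ N ⟧ s ρ) (map var is)
      ⟪vars⟫ = trans (sym (map-∘ _ var is)) (map-∘ _ var is)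
    ... | nothing = mk⇔
      -- The witness is ∼ₖ-related to the values of the arguments, so compatibility carries `R` over
      -- to those values.
      (λ (xs , r , es) → to (rel-over R over) (from (compatible-rel R _ xs es) r))
      -- The values themselves serve as witness; ∼ₖ is reflexive as the kernel of `π`.
      (λ r → _ , from (rel-over R over) r , PW.refl (from (π-sim _ _) E.refl))
      ⇔-∘ Sat-∃-block R ts ρ
      where
      over = terms-over ps ts

    Sat-convert : ∀ {ρ σ} → Pointwise Over ρ σ → (φ : Formula L n) →
                  Sat N (convert {L₁ = L₁} {L₂} d₁ d₂ k φ) ρ ⇔ Sat M φ σ
    Sat-convert ps (s ≐ s′)   = sim-over (term-over ps s) (term-over ps s′)
    Sat-convert ps (rel R ts) = Sat-convertRel ps R ts
    Sat-convert ps ⊤′         = ⇔-id _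
    Sat-convert ps ⊥′         = ⇔-id _
    Sat-convert ps (¬′ φ)     = →-cong-⇔ (Sat-convert ps φ) (⇔-id _)
    Sat-convert ps (φ ∧′ ψ)   = Sat-convert ps φ ×-⇔ Sat-convert ps ψ
    Sat-convert ps (φ ∨′ ψ)   = Sat-convert ps φ ⊎-⇔ Sat-convert ps ψ
    Sat-convert ps (φ ⇒′ ψ)   = →-cong-⇔ (Sat-convert ps φ) (Sat-convert ps ψ)
    -- Elements of `N` are pushed along `π`; elements of `M` are lifted by surjectivity, here and
    -- for `∀′`.
    Sat-convert ps (∃′ φ)     = mk⇔
      (λ (x , p) → π x , to (Sat-convert (E.refl ∷ ps) φ) p)
      (λ (a , p) → let x , x↦a = π-surj a in x , from (Sat-convert (x↦a ∷ ps) φ) p)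
    Sat-convert ps (∀′ φ)     = mk⇔
      (λ p a → let x , x↦a = π-surj a in to (Sat-convert (x↦a ∷ ps) φ) (p x))
      (λ p x → from (Sat-convert (E.refl ∷ ps) φ) (p (π x)))

  -- The standard simple product is a model.

  module _ (M₁ : Structure L₁ u) (M₂ : Structure L₂ u) where
    private
      module M₁ = Structure M₁
      module M₂ = Structure M₂
      module E₁ = Setoid M₁.setoid
      module E₂ = Setoid M₂.setoid

    coordinate₁ : Coordinate one (M₁ ⊗ M₂) M₁
    coordinate₁ = record
      { π       = proj₁
      -- Surjectivity of a projection needs the other factor inhabited, which its fixed constant
      -- ensures.
      ; π-surj  = λ a → (a , M₂.constᴹ d₂) , E₁.refl
      ; π-sim   = λ _ _ → ⇔-id _
      ; π-rel   = λ _ _ → ⇔-id _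
      ; π-const = λ _ → E₁.refl
      }

    coordinate₂ : Coordinate two (M₁ ⊗ M₂) M₂
    coordinate₂ = record
      { π       = proj₂
      ; π-surj  = λ b → (M₁.constᴹ d₁ , b) , E₂.refl
      ; π-sim   = λ _ _ → ⇔-id _
      ; π-rel   = λ _ _ → ⇔-id _
      ; π-const = λ _ → E₂.refl
      }

    ⊗⊨T× : M₁ ⊗ M₂ ⊨ T×
    ⊗⊨T× _ (∼-refl one)  _                 = E₁.refl
    ⊗⊨T× _ (∼-refl two)  _                 = E₂.refl
    ⊗⊨T× _ (∼-sym one)   _ _               = E₁.sym
    ⊗⊨T× _ (∼-sym two)   _ _               = E₂.sym
    ⊗⊨T× _ (∼-trans one) _ _ _ (p , q)     = E₁.trans p q
    ⊗⊨T× _ (∼-trans two) _ _ _ (p , q)     = E₂.trans p q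
    -- Agreement in both coordinates is by definition equality in the product setoid.
    ⊗⊨T× _ ∼-sep         _ _               = id
    ⊗⊨T× _ ∼-join        (a , _) (_ , b)   = (a , b) , E₁.refl , E₂.refl

    ⊗⊨Tsim : {T₁ : Theory L₁ t} {T₂ : Theory L₂ t} →
              M₁ ⊨ T₁ → M₂ ⊨ T₂ → M₁ ⊗ M₂ ⊨ Tsim d₁ d₂ T₁ T₂
    ⊗⊨Tsim M₁⊨T₁ M₂⊨T₂ _ (product p)    = ⊗⊨T× _ p
    ⊗⊨Tsim M₁⊨T₁ M₂⊨T₂ _ (converted₁ {σ} p) =
      from (Transfer.Sat-convert coordinate₁ [] σ) (M₁⊨T₁ _ p)
    ⊗⊨Tsim M₁⊨T₁ M₂⊨T₂ _ (converted₂ {σ} p) =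
      from (Transfer.Sat-convert coordinate₂ [] σ) (M₂⊨T₂ _ p)
    ⊗⊨Tsim M₁⊨T₁ M₂⊨T₂ _ (compat one R) =
      from (Sat-compatible (M₁ ⊗ M₂) one R) (Transfer.compatible-rel coordinate₁ R)
    ⊗⊨Tsim M₁⊨T₁ M₂⊨T₂ _ (compat two R) =
      from (Sat-compatible (M₁ ⊗ M₂) two R) (Transfer.compatible-rel coordinate₂ R)

  -- Decomposition of a model into its two quotients.

  module Decompose {T₁ : Theory L₁ t} {T₂ : Theory L₂ t} (N : Structure (Lsim L₁ L₂) u)
                   (N⊨Tsim : N ⊨ Tsim d₁ d₂ T₁ T₂) (N⊨coherent : N ⊨ CoherentConstants) where
    private
      module N = Structure N
      module E = Setoid N.setoid

      axiom× : ∀ {σ} → T× σ → Sat N σ []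
      axiom× p = N⊨Tsim _ (product p)

    quotient : (k : Side) → Structure (lang L₁ L₂ k) u
    quotient k = record
      { setoid    = record
        { Carrier       = N.Carrier
        ; _≈_           = _≋_ N k
        ; isEquivalence = record
          { refl  = axiom× (∼-refl k) _
          ; sym   = axiom× (∼-sym k) _ _
          ; trans = λ p q → axiom× (∼-trans k) _ _ _ (p , q)
          }
        }
      -- The symbol is the one that `convert` chooses for `c`, so `π-const` will be mere
      -- reflexivity.
      ; constᴹ    = λ c → N.constᴹ (C {L₁ = L₁} {L₂} d₁ d₂ k c)
      ; relᴹ      = λ R → N.relᴹ (old k R)
      -- The compatibility axiom is what makes `R` well defined modulo ∼ₖ.
      ; relᴹ-resp = λ R ps → to (to (Sat-compatible N k R) (N⊨Tsim _ (compat k R)) _ _ ps)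
      }

    quotient-coordinate : ∀ k → Coordinate k N (quotient k)
    quotient-coordinate k = record
      { π       = id
      ; π-surj  = λ a → a , axiom× (∼-refl k) a
      ; π-sim   = λ _ _ → ⇔-id _
      ; π-rel   = λ R xs → ≡⇒⇔ (cong (N.relᴹ (old k R)) (sym (map-id xs)))
      ; π-const = λ _ → axiom× (∼-refl k) _
      }

    quotient₁⊨ : quotient one ⊨ T₁
    quotient₁⊨ σ p =
      to (Transfer.Sat-convert (quotient-coordinate one) [] σ) (N⊨Tsim _ (converted₁ p))

    quotient₂⊨ : quotient two ⊨ T₂
    quotient₂⊨ σ p =
      to (Transfer.Sat-convert (quotient-coordinate two) [] σ) (N⊨Tsim _ (converted₂ p))

    ≈⇒≋ : ∀ k {x y} → x N.≈ y → _≋_ N k x y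
    ≈⇒≋ k x≈y = N.relᴹ-resp (sim k) (E.refl ∷ x≈y ∷ []) (axiom× (∼-refl k) _)

    private
      diagonal : N.Carrier → N.Carrier × N.Carrier
      diagonal x = x , x

    diagonal-rel : ∀ R xs →
                   N.relᴹ R xs ⇔ Structure.relᴹ (quotient one ⊗ quotient two) R (map diagonal xs)
    diagonal-rel (old one R) xs =
      ≡⇒⇔ (cong (N.relᴹ (old one R)) (trans (sym (map-id xs)) (map-∘ proj₁ diagonal xs)))
    diagonal-rel (old two R) xs =
      ≡⇒⇔ (cong (N.relᴹ (old two R)) (trans (sym (map-id xs)) (map-∘ proj₂ diagonal xs)))
    diagonal-rel (sim one) (_ ∷ _ ∷ []) = ⇔-id _
    diagonal-rel (sim two) (_ ∷ _ ∷ []) = ⇔-id _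

    N≅quotients : N ≅ quotient one ⊗ quotient two
    N≅quotients = record
      { bijection  = record
        { to        = diagonal
        ; cong      = λ x≈y → ≈⇒≋ one x≈y , ≈⇒≋ two x≈y
        ; bijective =
            -- Equality of diagonal pairs means both ∼₁ and ∼₂, so separation gives injectivity.
            (λ p → axiom× ∼-sep _ _ p)
          -- The preimage of `(a , b)` is the point sharing its ∼₁-class with `a` and its ∼₂-class
          -- with `b`. Surjectivity for setoids asks the same of every `y` equal to `z`.
          , (λ (a , b) → let z , a∼z , b∼z = axiom× ∼-join a b in
               z , λ y≈z → axiom× (∼-trans one) _ _ _ (≈⇒≋ one y≈z , axiom× (∼-sym one) _ _ a∼z)
                         , axiom× (∼-trans two) _ _ _ (≈⇒≋ two y≈z , axiom× (∼-sym two) _ _ b∼z))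
        }
      -- In the quotients `c₁` and `c₂` are read as the symbols for `(c₁ , d₂)` and `(d₁ , c₂)`;
      -- coherence links these to the symbol for `(c₁ , c₂)`.
      ; const-pres = λ (c₁ , c₂) → N⊨coherent _ (coherent₁ c₁ c₂ d₂)
                                 , N⊨coherent _ (coherent₂ c₁ d₁ c₂)
      ; rel-pres   = diagonal-rel
      }

theorem2p8 : {l t u : Level} (L₁ L₂ : Language l) (d₁ : Const L₁) (d₂ : Const L₂)
    (T₁ : Theory L₁ t) (T₂ : Theory L₂ t) →
    ((M₁ : Structure L₁ u) (M₂ : Structure L₂ u) →
    M₁ ⊨ T₁ → M₂ ⊨ T₂ → M₁ ⊗ M₂ ⊨ Tsim d₁ d₂ T₁ T₂)
    ×
    ((N : Structure (Lsim L₁ L₂) u) →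
    N ⊨ Tsim d₁ d₂ T₁ T₂ → N ⊨ CoherentConstants →
    ∃[ M₁ ] ∃[ M₂ ] (M₁ ⊨ T₁ × M₂ ⊨ T₂ × N ≅ M₁ ⊗ M₂))
theorem2p8 L₁ L₂ d₁ d₂ T₁ T₂ =
  (λ M₁ M₂ → ⊗⊨Tsim d₁ d₂ M₁ M₂) ,
  (λ N N⊨Tsim N⊨coherent → let open Decompose d₁ d₂ N N⊨Tsim N⊨coherent in
    quotient one , quotient two , quotient₁⊨ , quotient₂⊨ , N≅quotients)
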